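{- A strengthened syllogism is valid if and only if it is provable in the formal system $\mathrm{SYLL}^+$. That is: for every syllogism $P_1,P_2\vdash C$ in the term-variables $S,P,M$ taken together with an existential import assumption "some $X$ exists" for one $X\in\{S,M,P\}$, the syllogism is a valid strengthened syllogism under the assumption on $X$ if and only if it is provable in $\mathrm{SYLL}^+$ with the existential import on $X$.
   Context: **Categorical propositions.** For term-variables $A,B$ there are four categorical propositions with subject $A$ and predicate $B$: $\mathbf{A}_{AB}$ (Each $A$ is $B$), $\mathbf{E}_{AB}$ (No $A$ is $B$), $\mathbf{I}_{AB}$ (Some $A$ is $B$), $\mathbf{O}_{AB}$ (Some $A$ is not $B$). **Syllogisms.** Let $S,P,M$ be three distinct term-variables. A syllogism is an expression $P_1,P_2\vdash C$ with $P_1,P_2,C$ categorical propositions, where the first premise $P_1$ involves exactly $M$ and $P$ (in either order, as subject and predicate), the second premise $P_2$ involves exactly $S$ and $M$ (in either order), and the conclusion $C$ has subject $S$ and predicate $P$. **Valid strengthened syllogisms.** A strengthened syllogism is one considered under existential import, i.e. an explicit assumption of existence of some $S$, $M$ or $P$. The valid ones, with their assumptions, are exactly the following 9: - some $S$ exists: $\mathbf{A}_{MP},\mathbf{A}_{SM}\vdash\mathbf{I}_{SP}$; $\mathbf{A}_{PM},\mathbf{E}_{SM}\vdash\mathbf{O}_{SP}$; $\mathbf{A}_{PM},\mathbf{E}_{MS}\vdash\mathbf{O}_{SP}$; $\mathbf{E}_{MP},\mathbf{A}_{SM}\vdash\mathbf{O}_{SP}$; $\mathbf{E}_{PM},\mathbf{A}_{SM}\vdash\mathbf{O}_{SP}$;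 - some $M$ exists: $\mathbf{A}_{MP},\mathbf{A}_{MS}\vdash\mathbf{I}_{SP}$; $\mathbf{E}_{PM},\mathbf{A}_{MS}\vdash\mathbf{O}_{SP}$; $\mathbf{E}_{MP},\mathbf{A}_{MS}\vdash\mathbf{O}_{SP}$; - some $P$ exists: $\mathbf{A}_{PM},\mathbf{A}_{MS}\vdash\mathbf{I}_{SP}$. **Diagrams.** The syntactic primitives are the symbols $\to$, $\leftarrow$, $\bullet$ and countably many term-variables $A,B,C,\dots$. A diagram is a finite list of arrow symbols ($\to$ or $\leftarrow$) separated by a single bullet or term-variable, beginning and ending at a term-variable (a single term-variable is a diagram). A part of a diagram is a finite list of consecutive components of it; parts are denoted $\mathcal{D},\mathcal{E}$. The categorical propositions are represented by the syllogistic diagrams $$\mathbf{A}_{AB}: A\to B,\quad \mathbf{E}_{AB}: A\to\bullet\leftarrow B,\quad \mathbf{I}_{AB}: A\leftarrow\bullet\to B,\quad \mathbf{O}_{AB}: A\leftarrow\bullet\to\bullet\leftarrow B.$$ The diagram $X\leftarrow\bullet\to X$ of $\mathbf{I}_{XX}$ represents existential import on $X$. **Rules of inference of $\mathrm{SYLL}^+$** (for all term-variables $A,B$ and all parts $\mathcal{D},\mathcal{E}$ such that the expressions are diagrams): 1. from $A\to B$ infer $B\leftarrow A$, and conversely; 2. from $A\to\bullet\leftarrow B$ infer $B\to\bullet\leftarrow A$; 3. from $A\leftarrow\bullet\to B$ infer $B\leftarrow\bullet\to A$; 4. from $A\leftarrow\bullet\to\bullet\leftarrow B$ infer $B\to\bullet\leftarrow\bullet\to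 A$, and conversely; 5. from the two diagrams $\mathcal{D}A$ and $A\mathcal{E}$ (in either order) infer the diagram $\mathcal{D}A\mathcal{E}$ obtained by overlapping them on the common extremal $A$; 6. from $\mathcal{D}\to A\to\mathcal{E}$ infer $\mathcal{D}\to\mathcal{E}$; 7. from $\mathcal{D}\leftarrow A\leftarrow\mathcal{E}$ infer $\mathcal{D}\leftarrow\mathcal{E}$; 8. (the rule added to SYLL) from no hypotheses infer $A\leftarrow\bullet\to A$. **Provability.** A proof tree is a tree in which each node is a diagram and each branching is an instance of a rule of inference. A syllogism is provable in $\mathrm{SYLL}^+$ with the existential import on $X$ if there is a proof tree whose root is the syllogistic diagram of its conclusion and whose topmost diagrams are the syllogistic diagrams of its two premises together with one instance $X\leftarrow\bullet\to X$ of rule 8. -}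

module Defs where

open import Data.List using (List; []; _∷_; _++_; [_])
open import Data.List.Relation.Binary.Permutation.Propositional using (_↭_)
open import Data.Nat using (ℕ)
open import Data.Product using (_×_; Σ-syntax)
open import Data.Sum using (_⊎_)
open import Relation.Binary.PropositionalEquality using (_≡_)

Var : Set
Var = ℕ

data Form : Set where
  𝐀 𝐄 𝐈 𝐎 : Form

infix 7 _⟨_,_⟩

record Proposition : Set where
  constructor _⟨_,_⟩
  field
    form      : Form
    subject   : Var
    predicate : Var

open Proposition public

-- The terms of a proposition are X and Y, in either order.
Involves : Proposition → Var → Var → Set
Involves Q X Y =
  (subject Q ≡ X × predicate Q ≡ Y) ⊎ (subject Q ≡ Y × predicate Q ≡ X)

record IsSyllogism (S P M : Var) (P₁ P₂ C : Proposition) : Set where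
  field
    firstPremise        : Involves P₁ M P
    secondPremise       : Involves P₂ S M
    conclusionSubject   : subject C ≡ S
    conclusionPredicate : predicate C ≡ P

-- ValidStrengthened S P M X P₁ P₂ C : the syllogism P₁ , P₂ ⊢ C is a valid
-- strengthened syllogism under the assumption that some X exists.  The
-- constructors carry the traditional names of the moods.
data ValidStrengthened (S P M : Var) :
       Var → Proposition → Proposition → Proposition → Set where
  barbari   : ValidStrengthened S P M S (𝐀 ⟨ M , P ⟩) (𝐀 ⟨ S , M ⟩) (𝐈 ⟨ S , P ⟩)
  camestros : ValidStrengthened S P M S (𝐀 ⟨ P , M ⟩) (𝐄 ⟨ S , M ⟩) (𝐎 ⟨ S , P ⟩)
  calemos   : ValidStrengthened S P M S (𝐀 ⟨ P , M ⟩) (𝐄 ⟨ M , S ⟩) (𝐎 ⟨ S , P ⟩)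
  celaront  : ValidStrengthened S P M S (𝐄 ⟨ M , P ⟩) (𝐀 ⟨ S , M ⟩) (𝐎 ⟨ S , P ⟩)
  cesaro    : ValidStrengthened S P M S (𝐄 ⟨ P , M ⟩) (𝐀 ⟨ S , M ⟩) (𝐎 ⟨ S , P ⟩)
  darapti   : ValidStrengthened S P M M (𝐀 ⟨ M , P ⟩) (𝐀 ⟨ M , S ⟩) (𝐈 ⟨ S , P ⟩)
  fesapo    : ValidStrengthened S P M M (𝐄 ⟨ P , M ⟩) (𝐀 ⟨ M , S ⟩) (𝐎 ⟨ S , P ⟩)
  felapton  : ValidStrengthened S P M M (𝐄 ⟨ M , P ⟩) (𝐀 ⟨ M , S ⟩) (𝐎 ⟨ S , P ⟩)
  bamalip   : ValidStrengthened S P M P (𝐀 ⟨ P , M ⟩) (𝐀 ⟨ M , S ⟩) (𝐈 ⟨ S , P ⟩)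

data Symbol : Set where
  ⟶ ⟵ • : Symbol
  var   : Var → Symbol

data IsArrow : Symbol → Set where
  right : IsArrow ⟶
  left  : IsArrow ⟵

data IsNode : Symbol → Set where
  bullet : IsNode •
  term   : ∀ A → IsNode (var A)

-- Nodes separated by single arrows, the last node being a term-variable.
data Alternating : List Symbol → Set where
  end  : ∀ A → Alternating [ var A ]
  step : ∀ {x a w} → IsNode x → IsArrow a → Alternating w →
         Alternating (x ∷ a ∷ w)

data IsDiagram : List Symbol → Set where
  diagram : ∀ {A w} → Alternating (var A ∷ w) → IsDiagram (var A ∷ w)

⟦_⟧ : Proposition → List Symbol
⟦ 𝐀 ⟨ A , B ⟩ ⟧ = var A ∷ ⟶ ∷ var B ∷ []
⟦ 𝐄 ⟨ A , B ⟩ ⟧ = var A ∷ ⟶ ∷ • ∷ ⟵ ∷ var B ∷ []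
⟦ 𝐈 ⟨ A , B ⟩ ⟧ = var A ∷ ⟵ ∷ • ∷ ⟶ ∷ var B ∷ []
⟦ 𝐎 ⟨ A , B ⟩ ⟧ = var A ∷ ⟵ ∷ • ∷ ⟶ ∷ • ∷ ⟵ ∷ var B ∷ []

-- Proof trees with the given root.  Every node is a diagram, by the side
-- conditions on `hypothesis`, `glue`, `compose⟶` and `compose⟵`.
data ProofTree : List Symbol → Set where

  hypothesis : ∀ {𝒟} → IsDiagram 𝒟 → ProofTree 𝒟

  A-reverse  : ∀ A B → ProofTree (var A ∷ ⟶ ∷ var B ∷ []) →
                       ProofTree (var B ∷ ⟵ ∷ var A ∷ [])
  A-reverse⁻ : ∀ A B → ProofTree (var B ∷ ⟵ ∷ var A ∷ []) →
                       ProofTree (var A ∷ ⟶ ∷ var B ∷ [])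

  E-reverse  : ∀ A B → ProofTree (var A ∷ ⟶ ∷ • ∷ ⟵ ∷ var B ∷ []) →
                       ProofTree (var B ∷ ⟶ ∷ • ∷ ⟵ ∷ var A ∷ [])

  I-reverse  : ∀ A B → ProofTree (var A ∷ ⟵ ∷ • ∷ ⟶ ∷ var B ∷ []) →
                       ProofTree (var B ∷ ⟵ ∷ • ∷ ⟶ ∷ var A ∷ [])

  O-reverse  : ∀ A B → ProofTree (var A ∷ ⟵ ∷ • ∷ ⟶ ∷ • ∷ ⟵ ∷ var B ∷ []) →
                       ProofTree (var B ∷ ⟶ ∷ • ∷ ⟵ ∷ • ∷ ⟶ ∷ var A ∷ [])
  O-reverse⁻ : ∀ A B → ProofTree (var B ∷ ⟶ ∷ • ∷ ⟵ ∷ • ∷ ⟶ ∷ var A ∷ []) →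
                       ProofTree (var A ∷ ⟵ ∷ • ∷ ⟶ ∷ • ∷ ⟵ ∷ var B ∷ [])

  -- The branches of a tree are unordered: provability below is invariant
  -- under permuting the hypotheses.
  glue       : ∀ 𝒟 A ℰ → IsDiagram (𝒟 ++ var A ∷ ℰ) →
               ProofTree (𝒟 ++ var A ∷ []) → ProofTree (var A ∷ ℰ) →
               ProofTree (𝒟 ++ var A ∷ ℰ)

  compose⟶   : ∀ 𝒟 A ℰ → IsDiagram (𝒟 ++ ⟶ ∷ ℰ) →
               ProofTree (𝒟 ++ ⟶ ∷ var A ∷ ⟶ ∷ ℰ) → ProofTree (𝒟 ++ ⟶ ∷ ℰ)
  compose⟵   : ∀ 𝒟 A ℰ → IsDiagram (𝒟 ++ ⟵ ∷ ℰ) →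
               ProofTree (𝒟 ++ ⟵ ∷ var A ∷ ⟵ ∷ ℰ) → ProofTree (𝒟 ++ ⟵ ∷ ℰ)

  import∃    : ∀ A → ProofTree (var A ∷ ⟵ ∷ • ∷ ⟶ ∷ var A ∷ [])

-- The topmost diagrams are listed with multiplicity: the hypotheses, and
-- separately (by their variable) the instances of existential import.

hypotheses : ∀ {𝒟} → ProofTree 𝒟 → List (List Symbol)
hypotheses (hypothesis {𝒟} _)    = [ 𝒟 ]
hypotheses (A-reverse _ _ t)     = hypotheses t
hypotheses (A-reverse⁻ _ _ t)    = hypotheses t
hypotheses (E-reverse _ _ t)     = hypotheses t
hypotheses (I-reverse _ _ t)     = hypotheses t
hypotheses (O-reverse _ _ t)     = hypotheses t
hypotheses (O-reverse⁻ _ _ t)    = hypotheses t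
hypotheses (glue _ _ _ _ s t)    = hypotheses s ++ hypotheses t
hypotheses (compose⟶ _ _ _ _ t)  = hypotheses t
hypotheses (compose⟵ _ _ _ _ t)  = hypotheses t
hypotheses (import∃ _)           = []

imports : ∀ {𝒟} → ProofTree 𝒟 → List Var
imports (hypothesis _)        = []
imports (A-reverse _ _ t)     = imports t
imports (A-reverse⁻ _ _ t)    = imports t
imports (E-reverse _ _ t)     = imports t
imports (I-reverse _ _ t)     = imports t
imports (O-reverse _ _ t)     = imports t
imports (O-reverse⁻ _ _ t)    = imports t
imports (glue _ _ _ _ s t)    = imports s ++ imports t
imports (compose⟶ _ _ _ _ t)  = imports t
imports (compose⟵ _ _ _ _ t)  = imports t
imports (import∃ A)           = [ A ]

ProvableWithImport : Var → Proposition → Proposition → Proposition → Set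
ProvableWithImport X P₁ P₂ C =
  Σ[ t ∈ ProofTree ⟦ C ⟧ ]
    (hypotheses t ↭ ⟦ P₁ ⟧ ∷ ⟦ P₂ ⟧ ∷ [] × imports t ≡ [ X ])

{-# OPTIONS --safe #-}

-- Provable syllogisms are valid: no rule creates or destroys a bullet, so the
-- bullets of the conclusion are those of the premises plus the one of the
-- import.  This leaves few combinations of forms.  The rules are also sound for
-- interpretations over a one-element universe, and such an interpretation
-- refutes every remaining invalid combination.

module Submission where

open import Defs
open import Algebra.Properties.CommutativeSemigroup using (interchange)
open import Data.Bool using (Bool; true; false; not; _≤_; b≤b; f≤t)
open import Data.Bool.Properties using (_≤?_; ≤-trans; ≤-minimum)
open import Data.Empty using (⊥-elim)
open import Data.List using (List; []; _∷_; _++_; [_]; length; map)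
open import Data.List.Properties using (length-++; map-++)
open import Data.List.Relation.Binary.Permutation.Propositional
  using (↭-sym; ↭-refl; ↭-swap)
open import Data.List.Relation.Binary.Permutation.Propositional.Properties
  using (All-resp-↭; map⁺)
open import Data.List.Relation.Unary.All using (All; []; _∷_)
open import Data.List.Relation.Unary.All.Properties using (++⁻ˡ; ++⁻ʳ)
open import Data.Nat using (ℕ; suc; _+_; _≟_)
open import Data.Nat.ListAction using (sum)
open import Data.Nat.ListAction.Properties using (sum-++; sum-↭)
open import Data.Nat.Properties using (+-commutativeSemigroup; +-identityʳ)
open import Data.Product using (Σ-syntax; _×_; _,_)
open import Data.Sum using (_⊎_; inj₁; inj₂)
open import Function.Bundles using (_⇔_; mk⇔)
open import Relation.Binary.PropositionalEquality
  using (_≡_; _≢_; refl; sym; trans; cong; cong₂; subst; module ≡-Reasoning)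
open import Relation.Nullary using (Dec; yes; no; contradiction)
open import Relation.Nullary.Decidable
  using (True; fromWitness; _×-dec_; _→-dec_)

-- Derivations of the valid moods

⟦⟧-isDiagram : ∀ Q → IsDiagram ⟦ Q ⟧
⟦⟧-isDiagram (𝐀 ⟨ A , B ⟩) = diagram (step (term A) right (end B))
⟦⟧-isDiagram (𝐄 ⟨ A , B ⟩) =
  diagram (step (term A) right (step bullet left (end B)))
⟦⟧-isDiagram (𝐈 ⟨ A , B ⟩) =
  diagram (step (term A) left (step bullet right (end B)))
⟦⟧-isDiagram (𝐎 ⟨ A , B ⟩) =
  diagram (step (term A) left (step bullet right (step bullet left (end B))))

premise : ∀ Q → ProofTree ⟦ Q ⟧
premise Q = hypothesis (⟦⟧-isDiagram Q)

-- The middle term `B` is eliminated in two moves: the diagrams are glued at `B`, and the two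
-- parallel arrows around it merge into one. The next two derived rules follow the same pattern;
-- only here must the `𝐀` premise first be reversed to put `B` at its left end.
AE⇒E : ∀ {A B C} → ProofTree ⟦ 𝐄 ⟨ A , B ⟩ ⟧ → ProofTree ⟦ 𝐀 ⟨ C , B ⟩ ⟧ →
       ProofTree ⟦ 𝐄 ⟨ A , C ⟩ ⟧
AE⇒E {A} {B} {C} t u =
  compose⟵ (var A ∷ ⟶ ∷ • ∷ []) B [ var C ] (⟦⟧-isDiagram (𝐄 ⟨ A , C ⟩))
    (glue (var A ∷ ⟶ ∷ • ∷ ⟵ ∷ []) B (⟵ ∷ var C ∷ [])
      (diagram (step (term A) right (step bullet left
        (step (term B) left (end C)))))
      t (A-reverse C B u))

IA⇒I : ∀ {A B C} → ProofTree ⟦ 𝐈 ⟨ A , B ⟩ ⟧ → ProofTree ⟦ 𝐀 ⟨ B , C ⟩ ⟧ →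
       ProofTree ⟦ 𝐈 ⟨ A , C ⟩ ⟧
IA⇒I {A} {B} {C} t u =
  compose⟶ (var A ∷ ⟵ ∷ • ∷ []) B [ var C ] (⟦⟧-isDiagram (𝐈 ⟨ A , C ⟩))
    (glue (var A ∷ ⟵ ∷ • ∷ ⟶ ∷ []) B (⟶ ∷ var C ∷ [])
      (diagram (step (term A) left (step bullet right
        (step (term B) right (end C)))))
      t u)

IE⇒O : ∀ {A B C} → ProofTree ⟦ 𝐈 ⟨ A , B ⟩ ⟧ → ProofTree ⟦ 𝐄 ⟨ B , C ⟩ ⟧ →
       ProofTree ⟦ 𝐎 ⟨ A , C ⟩ ⟧
IE⇒O {A} {B} {C} t u =
  compose⟶ (var A ∷ ⟵ ∷ • ∷ []) B (• ∷ ⟵ ∷ var C ∷ [])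
    (⟦⟧-isDiagram (𝐎 ⟨ A , C ⟩))
    (glue (var A ∷ ⟵ ∷ • ∷ ⟶ ∷ []) B (⟶ ∷ • ∷ ⟵ ∷ var C ∷ [])
      (diagram (step (term A) left (step bullet right
        (step (term B) right (step bullet left (end C))))))
      t u)

-- Each derivation extends the import diagram of `X` by the two universal premises, reversing an `𝐄`
-- or the `𝐈` obtained so far where the shared term is at the wrong end.
valid⇒provable : ∀ {S P M X P₁ P₂ C} → ValidStrengthened S P M X P₁ P₂ C →
                 ProvableWithImport X P₁ P₂ C
valid⇒provable {S} {P} {M} barbari =
  IA⇒I (IA⇒I (import∃ S) (premise (𝐀 ⟨ S , M ⟩))) (premise (𝐀 ⟨ M , P ⟩)) ,
  -- The tree meets the second premise before the first; only `bamalip` uses them in the stated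
  -- order.
  ↭-swap _ _ ↭-refl , refl
valid⇒provable {S} {P} {M} camestros =
  IE⇒O (import∃ S) (AE⇒E (premise (𝐄 ⟨ S , M ⟩)) (premise (𝐀 ⟨ P , M ⟩))) ,
  ↭-swap _ _ ↭-refl , refl
valid⇒provable {S} {P} {M} calemos =
  IE⇒O (import∃ S)
    (AE⇒E (E-reverse M S (premise (𝐄 ⟨ M , S ⟩))) (premise (𝐀 ⟨ P , M ⟩))) ,
  ↭-swap _ _ ↭-refl , refl
valid⇒provable {S} {P} {M} celaront =
  IE⇒O (IA⇒I (import∃ S) (premise (𝐀 ⟨ S , M ⟩))) (premise (𝐄 ⟨ M , P ⟩)) ,
  ↭-swap _ _ ↭-refl , refl
valid⇒provable {S} {P} {M} cesaro =
  IE⇒O (IA⇒I (import∃ S) (premise (𝐀 ⟨ S , M ⟩)))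
    (E-reverse P M (premise (𝐄 ⟨ P , M ⟩))) ,
  ↭-swap _ _ ↭-refl , refl
valid⇒provable {S} {P} {M} darapti =
  IA⇒I (I-reverse M S (IA⇒I (import∃ M) (premise (𝐀 ⟨ M , S ⟩))))
    (premise (𝐀 ⟨ M , P ⟩)) ,
  ↭-swap _ _ ↭-refl , refl
valid⇒provable {S} {P} {M} fesapo =
  IE⇒O (I-reverse M S (IA⇒I (import∃ M) (premise (𝐀 ⟨ M , S ⟩))))
    (E-reverse P M (premise (𝐄 ⟨ P , M ⟩))) ,
  ↭-swap _ _ ↭-refl , refl
valid⇒provable {S} {P} {M} felapton =
  IE⇒O (I-reverse M S (IA⇒I (import∃ M) (premise (𝐀 ⟨ M , S ⟩))))
    (premise (𝐄 ⟨ M , P ⟩)) ,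
  ↭-swap _ _ ↭-refl , refl
valid⇒provable {S} {P} {M} bamalip =
  I-reverse P S
    (IA⇒I (IA⇒I (import∃ P) (premise (𝐀 ⟨ P , M ⟩))) (premise (𝐀 ⟨ M , S ⟩))) ,
  ↭-refl , refl

-- Conservation of bullets

bullets : List Symbol → ℕ
bullets []          = 0
bullets (• ∷ w)     = suc (bullets w)
bullets (⟶ ∷ w)     = bullets w
bullets (⟵ ∷ w)     = bullets w
bullets (var _ ∷ w) = bullets w

bullets-++ : ∀ u w → bullets (u ++ w) ≡ bullets u + bullets w
bullets-++ []          w = refl
bullets-++ (• ∷ u)     w = cong suc (bullets-++ u w)
bullets-++ (⟶ ∷ u)     w = bullets-++ u w
bullets-++ (⟵ ∷ u)     w = bullets-++ u w
bullets-++ (var _ ∷ u) w = bullets-++ u w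

bullets-++-cong : ∀ u {w w′} → bullets w ≡ bullets w′ →
                  bullets (u ++ w) ≡ bullets (u ++ w′)
bullets-++-cong u {w} {w′} eq = begin
  bullets (u ++ w)       ≡⟨ bullets-++ u w ⟩
  bullets u + bullets w  ≡⟨ cong (bullets u +_) eq ⟩
  bullets u + bullets w′ ≡⟨ bullets-++ u w′ ⟨
  bullets (u ++ w′)      ∎
  where open ≡-Reasoning

total : List (List Symbol) → ℕ
total ws = sum (map bullets ws)

total-++ : ∀ us ws → total (us ++ ws) ≡ total us + total ws
total-++ us ws =
  trans (cong sum (map-++ bullets us ws)) (sum-++ (map bullets us) _)

-- Reversals rearrange symbols, gluing identifies two copies of a variable, and composition deletes
-- a variable and an arrow; none affects bullets. Each import contributes one bullet, counted by the
-- length of `imports t`.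
bullets-conserved : ∀ {𝒟} (t : ProofTree 𝒟) →
                    length (imports t) + total (hypotheses t) ≡ bullets 𝒟
bullets-conserved (hypothesis _)         = +-identityʳ _
bullets-conserved (A-reverse _ _ t)      = bullets-conserved t
bullets-conserved (A-reverse⁻ _ _ t)     = bullets-conserved t
bullets-conserved (E-reverse _ _ t)      = bullets-conserved t
bullets-conserved (I-reverse _ _ t)      = bullets-conserved t
bullets-conserved (O-reverse _ _ t)      = bullets-conserved t
bullets-conserved (O-reverse⁻ _ _ t)     = bullets-conserved t
bullets-conserved (compose⟶ 𝒟 _ _ _ t)   =
  trans (bullets-conserved t) (bullets-++-cong 𝒟 refl)
bullets-conserved (compose⟵ 𝒟 _ _ _ t)   =
  trans (bullets-conserved t) (bullets-++-cong 𝒟 refl)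
bullets-conserved (import∃ _)            = refl
bullets-conserved (glue 𝒟 A ℰ _ s t) = begin
  length (imports s ++ imports t) + total (hypotheses s ++ hypotheses t)
    ≡⟨ cong₂ _+_ (length-++ (imports s)) (total-++ (hypotheses s) _) ⟩
  (length (imports s) + length (imports t)) +
  (total (hypotheses s) + total (hypotheses t))
    ≡⟨ interchange +-commutativeSemigroup (length (imports s)) _ _ _ ⟩
  (length (imports s) + total (hypotheses s)) +
  (length (imports t) + total (hypotheses t))
    ≡⟨ cong₂ _+_ (bullets-conserved s) (bullets-conserved t) ⟩
  bullets (𝒟 ++ var A ∷ []) + bullets ℰ
    ≡⟨ cong (_+ bullets ℰ) (bullets-++ 𝒟 _) ⟩
  (bullets 𝒟 + 0) + bullets ℰ
    ≡⟨ cong (_+ bullets ℰ) (+-identityʳ _) ⟩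
  bullets 𝒟 + bullets ℰ
    ≡⟨ bullets-++ 𝒟 _ ⟨
  bullets (𝒟 ++ var A ∷ ℰ) ∎
  where open ≡-Reasoning

-- The `suc` is the bullet of the single import. Once the three forms are known, both sides are
-- numerals, so matching on `refl` discards most combinations.
provable⇒bullets : ∀ {X P₁ P₂ C} → ProvableWithImport X P₁ P₂ C →
                   suc (bullets ⟦ P₁ ⟧ + (bullets ⟦ P₂ ⟧ + 0)) ≡ bullets ⟦ C ⟧
provable⇒bullets (t , hyps , imps) =
  trans (sym (cong₂ _+_ (cong length imps) (sum-↭ (map⁺ bullets hyps))))
        (bullets-conserved t)

-- Interpretations over a one-element universe

-- What has been read of a diagram bounds its next node from below (after ⟶) or
-- from above (after ⟵).  In `node l h` these are the bounds in force once the
-- next arrow is read: both are the value at a variable.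
data State : Set where
  start : State
  node  : (lower upper : Bool) → State
  above : Bool → State
  below : Bool → State

-- A bullet after ⟵ is a nonempty set, hence `true`.  A bullet y after ⟶ occurs
-- as x ⟶ • ⟵ z and means x ≤ y and z ≤ not y for some y; taking y = x loses
-- nothing, hence the upper bound `not x`.
data Step (v : Var → Bool) : State → Symbol → State → Set where
  start     : ∀ {A} → Step v start (var A) (node (v A) (v A))
  ⟶         : ∀ {l h} → Step v (node l h) ⟶ (above l)
  ⟵         : ∀ {l h} → Step v (node l h) ⟵ (below h)
  above     : ∀ {b A} → b ≤ v A → Step v (above b) (var A) (node (v A) (v A))
  below     : ∀ {b A} → v A ≤ b → Step v (below b) (var A) (node (v A) (v A))
  disjoint  : ∀ {b} → Step v (above b) • (node true (not b))
  inhabited : ∀ {b} → true ≤ b → Step v (below b) • (node true true)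

data Run (v : Var → Bool) : State → List Symbol → Set where
  done : ∀ {l h} → Run v (node l h) []
  _∷_  : ∀ {q x q′ w} → Step v q x q′ → Run v q′ w → Run v q (x ∷ w)

_⊨_ : (Var → Bool) → List Symbol → Set
v ⊨ w = Run v start w

-- Soundness of the rules of inference

≤-not-swap : ∀ {a b} → b ≤ not a → a ≤ not b
≤-not-swap {false}         _  = ≤-minimum _
≤-not-swap {true}  {false} _  = b≤b

not-antitone : ∀ {a b} → a ≤ b → not b ≤ not a
not-antitone b≤b = b≤b
not-antitone f≤t = f≤t

below-mono : ∀ {v b c w} → b ≤ c → Run v (below b) w → Run v (below c) w
below-mono b≤c (below p ∷ r)     = below (≤-trans p b≤c) ∷ r
below-mono b≤c (inhabited p ∷ r) = inhabited (≤-trans p b≤c) ∷ r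

node-mono : ∀ {v l h k w} → h ≤ k → Run v (node l h) w → Run v (node l k) w
node-mono h≤k done    = done
node-mono h≤k (⟶ ∷ r) = ⟶ ∷ r
node-mono h≤k (⟵ ∷ r) = ⟵ ∷ below-mono h≤k r

-- A smaller lower bound asks less of the next node. A variable resets the state, but at a
-- disjointness bullet negation turns the bound into a larger upper bound, so the weakening must be
-- carried past the bullet.
above-antitone : ∀ {v b c w} → c ≤ b → Run v (above b) w → Run v (above c) w
above-antitone c≤b (above p ∷ r)  = above (≤-trans c≤b p) ∷ r
above-antitone c≤b (disjoint ∷ r) = disjoint ∷ node-mono (not-antitone c≤b) r

-- A change of suffix that works from every state works after any prefix, so a rule need only be
-- checked where it acts.
Run-++ : ∀ {v q} u {w w′} → (∀ {q} → Run v q w → Run v q w′) →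
         Run v q (u ++ w) → Run v q (u ++ w′)
Run-++ []      f r       = f r
Run-++ (_ ∷ u) f (s ∷ r) = s ∷ Run-++ u f r

-- After a variable the state is `node (v A) (v A)` however it was reached, so the run of the second
-- diagram continues that of the first.
Run-glue : ∀ {v q A w} → v ⊨ (var A ∷ w) →
           Run v q (var A ∷ []) → Run v q (var A ∷ w)
Run-glue (start ∷ r) (start ∷ _)   = start ∷ r
Run-glue (start ∷ r) (above p ∷ _) = above p ∷ r
Run-glue (start ∷ r) (below p ∷ _) = below p ∷ r

Run-compose⟶ : ∀ {v q A w} → Run v q (⟶ ∷ var A ∷ ⟶ ∷ w) → Run v q (⟶ ∷ w)
Run-compose⟶ (⟶ ∷ above p ∷ ⟶ ∷ r) = ⟶ ∷ above-antitone p r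

Run-compose⟵ : ∀ {v q A w} → Run v q (⟵ ∷ var A ∷ ⟵ ∷ w) → Run v q (⟵ ∷ w)
Run-compose⟵ (⟵ ∷ below p ∷ ⟵ ∷ r) = ⟵ ∷ below-mono p r

sound : ∀ {v 𝒟} (t : ProofTree 𝒟) → All (v ⊨_) (hypotheses t) →
        All (λ A → true ≤ v A) (imports t) → v ⊨ 𝒟
sound (hypothesis _) (h ∷ []) _ = h
sound (A-reverse _ _ t) hs is with sound t hs is
... | start ∷ ⟶ ∷ above p ∷ done = start ∷ ⟵ ∷ below p ∷ done
sound (A-reverse⁻ _ _ t) hs is with sound t hs is
... | start ∷ ⟵ ∷ below p ∷ done = start ∷ ⟶ ∷ above p ∷ done
sound (E-reverse _ _ t) hs is with sound t hs is
... | start ∷ ⟶ ∷ disjoint ∷ ⟵ ∷ below p ∷ done =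
  -- Disjointness is read asymmetrically, as `z ≤ not x`, so reversal is contraposition.
  start ∷ ⟶ ∷ disjoint ∷ ⟵ ∷ below (≤-not-swap p) ∷ done
sound (I-reverse _ _ t) hs is with sound t hs is
... | start ∷ ⟵ ∷ inhabited p ∷ ⟶ ∷ above q ∷ done =
  start ∷ ⟵ ∷ inhabited q ∷ ⟶ ∷ above p ∷ done
sound (O-reverse _ _ t) hs is with sound t hs is
... | start ∷ ⟵ ∷ inhabited p ∷ ⟶ ∷ disjoint ∷ ⟵ ∷ below q ∷ done =
  start ∷ ⟶ ∷ disjoint ∷ ⟵ ∷ inhabited (≤-not-swap q) ∷ ⟶ ∷ above p ∷ done
sound (O-reverse⁻ _ _ t) hs is with sound t hs is
... | start ∷ ⟶ ∷ disjoint ∷ ⟵ ∷ inhabited q ∷ ⟶ ∷ above p ∷ done =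
  start ∷ ⟵ ∷ inhabited p ∷ ⟶ ∷ disjoint ∷ ⟵ ∷ below (≤-not-swap q) ∷ done
sound (glue 𝒟 _ _ _ s t) hs is =
  Run-++ 𝒟 (Run-glue (sound t (++⁻ʳ (hypotheses s) hs) (++⁻ʳ (imports s) is)))
    (sound s (++⁻ˡ (hypotheses s) hs) (++⁻ˡ (imports s) is))
sound (compose⟶ 𝒟 _ _ _ t) hs is = Run-++ 𝒟 Run-compose⟶ (sound t hs is)
sound (compose⟵ 𝒟 _ _ _ t) hs is = Run-++ 𝒟 Run-compose⟵ (sound t hs is)
sound (import∃ _) _ (p ∷ []) = start ∷ ⟵ ∷ inhabited p ∷ ⟶ ∷ above p ∷ done

provable⇒entailed : ∀ {X P₁ P₂ C} → ProvableWithImport X P₁ P₂ C →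
                    ∀ {v} → v ⊨ ⟦ P₁ ⟧ → v ⊨ ⟦ P₂ ⟧ → true ≤ v X → v ⊨ ⟦ C ⟧
provable⇒entailed (t , hyps , imps) h₁ h₂ x =
  sound t (All-resp-↭ (↭-sym hyps) (h₁ ∷ h₂ ∷ []))
          (subst (All _) (sym imps) (x ∷ []))

-- These are exactly the bounds that a run checks along the diagram of each form, stated as
-- decidable conditions on the two truth values.
Truth : Form → Bool → Bool → Set
Truth 𝐀 a b = a ≤ b
Truth 𝐄 a b = b ≤ not a
Truth 𝐈 a b = true ≤ a × true ≤ b
Truth 𝐎 a b = true ≤ a × b ≤ false

truth? : ∀ f a b → Dec (Truth f a b)
truth? 𝐀 a b = a ≤? b
truth? 𝐄 a b = b ≤? not a
truth? 𝐈 a b = (true ≤? a) ×-dec (true ≤? b)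
truth? 𝐎 a b = (true ≤? a) ×-dec (b ≤? false)

Truth⇒⊨ : ∀ {v} f {A B} → Truth f (v A) (v B) → v ⊨ ⟦ f ⟨ A , B ⟩ ⟧
Truth⇒⊨ 𝐀 p       = start ∷ ⟶ ∷ above p ∷ done
Truth⇒⊨ 𝐄 p       = start ∷ ⟶ ∷ disjoint ∷ ⟵ ∷ below p ∷ done
Truth⇒⊨ 𝐈 (p , q) = start ∷ ⟵ ∷ inhabited p ∷ ⟶ ∷ above q ∷ done
Truth⇒⊨ 𝐎 (p , q) =
  start ∷ ⟵ ∷ inhabited p ∷ ⟶ ∷ disjoint ∷ ⟵ ∷ below q ∷ done

⊨⇒Truth : ∀ {v} f {A B} → v ⊨ ⟦ f ⟨ A , B ⟩ ⟧ → Truth f (v A) (v B)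
⊨⇒Truth 𝐀 (start ∷ ⟶ ∷ above p ∷ done)                             = p
⊨⇒Truth 𝐄 (start ∷ ⟶ ∷ disjoint ∷ ⟵ ∷ below p ∷ done)              = p
⊨⇒Truth 𝐈 (start ∷ ⟵ ∷ inhabited p ∷ ⟶ ∷ above q ∷ done)           = p , q
⊨⇒Truth 𝐎 (start ∷ ⟵ ∷ inhabited p ∷ ⟶ ∷ disjoint ∷ ⟵ ∷ below q ∷ done) =
  p , q

-- Refutation of the invalid moods

data Role : Set where
  minor major middle : Role

pick : {A : Set} → A → A → A → Role → A
pick s p m minor  = s
pick s p m major  = p
pick s p m middle = m

-- Distinctness of the three terms allows their values to be prescribed independently.
extension : ∀ {S P M} → S ≢ P → S ≢ M → P ≢ M → ∀ s p m →
            Σ[ v ∈ (Var → Bool) ] (∀ r → v (pick S P M r) ≡ pick s p m r)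
extension {S} {P} {M} S≢P S≢M P≢M s p m = v , agrees
  where
  v : Var → Bool
  v A with A ≟ S | A ≟ P
  ... | yes _ | _     = s
  ... | no  _ | yes _ = p
  -- The default value `m` serves `M` along with all remaining variables.
  ... | no  _ | no  _ = m

  agrees : ∀ r → v (pick S P M r) ≡ pick s p m r
  agrees minor with S ≟ S
  ... | yes _   = refl
  ... | no  S≢S = contradiction refl S≢S
  agrees major with P ≟ S | P ≟ P
  ... | yes refl | _       = contradiction refl S≢P
  ... | no  _    | yes _   = refl
  ... | no  _    | no  P≢P = contradiction refl P≢P
  agrees middle with M ≟ S | M ≟ P
  ... | yes refl | _        = contradiction refl S≢M
  ... | no  _    | yes refl = contradiction refl P≢M
  ... | no  _    | no  _    = refl

-- Wrapping the decision in `True` makes each instance at closed truth values compute to the unit or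
-- the empty type. A countermodel then refutes entailment by mere application.
Entails : (f₁ f₂ f₃ : Form) (a₁ b₁ a₂ b₂ x : Role) → Set
Entails f₁ f₂ f₃ a₁ b₁ a₂ b₂ x = ∀ s p m → let v = pick s p m in
  True (truth? f₁ (v a₁) (v b₁) →-dec truth? f₂ (v a₂) (v b₂) →-dec
        (true ≤? v x) →-dec truth? f₃ s p)

provable⇒entails : ∀ {S P M} → S ≢ P → S ≢ M → P ≢ M →
  ∀ f₁ f₂ f₃ a₁ b₁ a₂ b₂ x → let var = pick S P M in
  ProvableWithImport (var x) (f₁ ⟨ var a₁ , var b₁ ⟩) (f₂ ⟨ var a₂ , var b₂ ⟩)
    (f₃ ⟨ S , P ⟩) →
  Entails f₁ f₂ f₃ a₁ b₁ a₂ b₂ x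
provable⇒entails S≢P S≢M P≢M f₁ f₂ f₃ a₁ b₁ a₂ b₂ x pf s p m
  with extension S≢P S≢M P≢M s p m
... | v , agrees
  -- The prescribed truth values are traded for values of `v`, the form in which soundness applies.
  rewrite sym (agrees a₁) | sym (agrees b₁) | sym (agrees a₂) | sym (agrees b₂)
        | sym (agrees x) | sym (agrees minor) | sym (agrees major) =
  fromWitness λ h₁ h₂ hx →
    ⊨⇒Truth f₃ (provable⇒entailed pf (Truth⇒⊨ f₁ h₁) (Truth⇒⊨ f₂ h₂) hx)

data Mood : Form → Form → Form → Set where
  AAI : Mood 𝐀 𝐀 𝐈
  AEO : Mood 𝐀 𝐄 𝐎
  EAO : Mood 𝐄 𝐀 𝐎

-- AAE, AIO and IAO have the right number of bullets, but fail where every term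
-- is nonempty.
mood : ∀ P₁ P₂ C → let full = λ _ → true in
  suc (bullets ⟦ P₁ ⟧ + (bullets ⟦ P₂ ⟧ + 0)) ≡ bullets ⟦ C ⟧ →
  (full ⊨ ⟦ P₁ ⟧ → full ⊨ ⟦ P₂ ⟧ → full ⊨ ⟦ C ⟧) →
  Mood (form P₁) (form P₂) (form C)
mood (𝐀 ⟨ _ , _ ⟩) (𝐀 ⟨ _ , _ ⟩) (𝐈 ⟨ _ , _ ⟩) refl e = AAI
mood (𝐀 ⟨ _ , _ ⟩) (𝐄 ⟨ _ , _ ⟩) (𝐎 ⟨ _ , _ ⟩) refl e = AEO
mood (𝐄 ⟨ _ , _ ⟩) (𝐀 ⟨ _ , _ ⟩) (𝐎 ⟨ _ , _ ⟩) refl e = EAO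
mood (𝐀 ⟨ _ , _ ⟩) (𝐀 ⟨ _ , _ ⟩) (𝐄 ⟨ _ , _ ⟩) refl e
  with () ← ⊨⇒Truth 𝐄 (e (Truth⇒⊨ 𝐀 b≤b) (Truth⇒⊨ 𝐀 b≤b))
mood (𝐀 ⟨ _ , _ ⟩) (𝐈 ⟨ _ , _ ⟩) (𝐎 ⟨ _ , _ ⟩) refl e
  with () ← ⊨⇒Truth 𝐎 (e (Truth⇒⊨ 𝐀 b≤b) (Truth⇒⊨ 𝐈 (b≤b , b≤b)))
mood (𝐈 ⟨ _ , _ ⟩) (𝐀 ⟨ _ , _ ⟩) (𝐎 ⟨ _ , _ ⟩) refl e
  with () ← ⊨⇒Truth 𝐎 (e (Truth⇒⊨ 𝐈 (b≤b , b≤b)) (Truth⇒⊨ 𝐀 b≤b))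

-- In this and the other figures, the arguments of `e` are the truth values of `S`, `P` and `M`, in
-- this order, in a countermodel: premises and import hold, the conclusion fails.
figure1 : ∀ {S P M f₁ f₂ f₃} → Mood f₁ f₂ f₃ → ∀ x →
  Entails f₁ f₂ f₃ middle major minor middle x →
  ValidStrengthened S P M (pick S P M x)
    (f₁ ⟨ M , P ⟩) (f₂ ⟨ S , M ⟩) (f₃ ⟨ S , P ⟩)
figure1 AAI minor  e = barbari
figure1 AAI major  e = ⊥-elim (e false true false)
figure1 AAI middle e = ⊥-elim (e false true true)
figure1 AEO minor  e = ⊥-elim (e true true false)
figure1 AEO major  e = ⊥-elim (e false true false)
figure1 AEO middle e = ⊥-elim (e false true true)
figure1 EAO minor  e = celaront
figure1 EAO major  e = ⊥-elim (e false true false)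
figure1 EAO middle e = ⊥-elim (e false false true)

figure2 : ∀ {S P M f₁ f₂ f₃} → Mood f₁ f₂ f₃ → ∀ x →
  Entails f₁ f₂ f₃ major middle minor middle x →
  ValidStrengthened S P M (pick S P M x)
    (f₁ ⟨ P , M ⟩) (f₂ ⟨ S , M ⟩) (f₃ ⟨ S , P ⟩)
figure2 AAI minor  e = ⊥-elim (e true false true)
figure2 AAI major  e = ⊥-elim (e false true true)
figure2 AAI middle e = ⊥-elim (e false false true)
figure2 AEO minor  e = camestros
figure2 AEO major  e = ⊥-elim (e false true true)
figure2 AEO middle e = ⊥-elim (e false false true)
figure2 EAO minor  e = cesaro
figure2 EAO major  e = ⊥-elim (e false true false)
figure2 EAO middle e = ⊥-elim (e false false true)

figure3 : ∀ {S P M f₁ f₂ f₃} → Mood f₁ f₂ f₃ → ∀ x →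
  Entails f₁ f₂ f₃ middle major middle minor x →
  ValidStrengthened S P M (pick S P M x)
    (f₁ ⟨ M , P ⟩) (f₂ ⟨ M , S ⟩) (f₃ ⟨ S , P ⟩)
figure3 AAI minor  e = ⊥-elim (e true false false)
figure3 AAI major  e = ⊥-elim (e false true false)
figure3 AAI middle e = darapti
figure3 AEO minor  e = ⊥-elim (e true true false)
figure3 AEO major  e = ⊥-elim (e false true false)
figure3 AEO middle e = ⊥-elim (e false true true)
figure3 EAO minor  e = ⊥-elim (e true true false)
figure3 EAO major  e = ⊥-elim (e false true false)
figure3 EAO middle e = felapton

figure4 : ∀ {S P M f₁ f₂ f₃} → Mood f₁ f₂ f₃ → ∀ x →
  Entails f₁ f₂ f₃ major middle middle minor x →
  ValidStrengthened S P M (pick S P M x)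
    (f₁ ⟨ P , M ⟩) (f₂ ⟨ M , S ⟩) (f₃ ⟨ S , P ⟩)
figure4 AAI minor  e = ⊥-elim (e true false false)
figure4 AAI major  e = bamalip
figure4 AAI middle e = ⊥-elim (e true false true)
figure4 AEO minor  e = calemos
figure4 AEO major  e = ⊥-elim (e false true true)
figure4 AEO middle e = ⊥-elim (e false false true)
figure4 EAO minor  e = ⊥-elim (e true true false)
figure4 EAO major  e = ⊥-elim (e false true false)
figure4 EAO middle e = fesapo

-- Case distinction by figure, and the equivalence

role : ∀ {S P M X : Var} → X ≡ S ⊎ X ≡ M ⊎ X ≡ P → Σ[ x ∈ Role ] X ≡ pick S P M x
role (inj₁ X≡S)        = minor , X≡S
role (inj₂ (inj₁ X≡M)) = middle , X≡M
role (inj₂ (inj₂ X≡P)) = major , X≡P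

provable⇒valid : ∀ {S P M} → S ≢ P → S ≢ M → P ≢ M →
  ∀ P₁ P₂ C → IsSyllogism S P M P₁ P₂ C → ∀ x →
  ProvableWithImport (pick S P M x) P₁ P₂ C →
  ValidStrengthened S P M (pick S P M x) P₁ P₂ C
provable⇒valid {S} {P} {M} S≢P S≢M P≢M
  P₁@(f₁ ⟨ _ , _ ⟩) P₂@(f₂ ⟨ _ , _ ⟩) C@(f₃ ⟨ .S , .P ⟩)
  record { firstPremise = first ; secondPremise = second
         ; conclusionSubject = refl ; conclusionPredicate = refl } x pf =
  figure first second
  where
  moodOf : Mood f₁ f₂ f₃
  moodOf = mood P₁ P₂ C (provable⇒bullets pf)
    -- Where every term is nonempty the import holds for any `X`, so the forms are settled before
    -- the choice of `x` matters.
    λ h₁ h₂ → provable⇒entailed pf h₁ h₂ b≤b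

  entails : ∀ a₁ b₁ a₂ b₂ → let var = pick S P M in
    ProvableWithImport (var x) (f₁ ⟨ var a₁ , var b₁ ⟩) (f₂ ⟨ var a₂ , var b₂ ⟩) C →
    Entails f₁ f₂ f₃ a₁ b₁ a₂ b₂ x
  entails a₁ b₁ a₂ b₂ = provable⇒entails S≢P S≢M P≢M f₁ f₂ f₃ a₁ b₁ a₂ b₂ x

  figure : Involves P₁ M P → Involves P₂ S M →
           ValidStrengthened S P M (pick S P M x) P₁ P₂ C
  figure (inj₁ (refl , refl)) (inj₁ (refl , refl)) =
    figure1 moodOf x (entails middle major minor middle pf)
  figure (inj₂ (refl , refl)) (inj₁ (refl , refl)) =
    figure2 moodOf x (entails major middle minor middle pf)
  figure (inj₁ (refl , refl)) (inj₂ (refl , refl)) =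
    figure3 moodOf x (entails middle major middle minor pf)
  figure (inj₂ (refl , refl)) (inj₂ (refl , refl)) =
    figure4 moodOf x (entails major middle middle minor pf)

theorem3p18 : (S P M : Var) → S ≢ P → S ≢ M → P ≢ M →
    (P₁ P₂ C : Proposition) → IsSyllogism S P M P₁ P₂ C →
    (X : Var) → (X ≡ S ⊎ X ≡ M ⊎ X ≡ P) →
    ValidStrengthened S P M X P₁ P₂ C ⇔ ProvableWithImport X P₁ P₂ C
theorem3p18 S P M S≢P S≢M P≢M P₁ P₂ C syllogism X X∈SMP
  with role X∈SMP
... | x , refl =
  mk⇔ valid⇒provable (provable⇒valid S≢P S≢M P≢M P₁ P₂ C syllogism x)
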